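{- For a step set $X\subseteq\mathbb{Z}^2\setminus\{O\}$ and a submonoid $\mathcal{C}$ of $\mathbb{Z}^2$, consider the following statements: (i) $(X,\mathcal{C})$ has the Infinite Paths Property (IPP); (ii) $O\in\operatorname{Conv}(X)$; (iii) $O\in\operatorname{Conv}(\mathcal{A}_X^{\mathcal{C}}\setminus\{O\})$; (iv) $\mathcal{A}_X^{\mathcal{C}}$ has non-trivial units (i.e. an invertible element other than $O$). Then the implications that hold among (i)–(iv) (for all such $X$ and $\mathcal{C}$) are precisely those inferrable from $$\text{(iii)}\iff\text{(iv)}\implies\text{(i)}\implies\text{(ii)}.$$ That is, these implications hold for all step sets $X$ and submonoids $\mathcal{C}$, while none of the implications (i)$\Rightarrow$(iii), (i)$\Rightarrow$(iv), (ii)$\Rightarrow$(i), (ii)$\Rightarrow$(iii), (ii)$\Rightarrow$(iv) holds for all step sets $X$ and submonoids $\mathcal{C}$.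
   Context: Write $O=(0,0)$. A step set is any (finite or infinite) subset $X$ of $\mathbb{Z}^2\setminus\{O\}$. $\mathcal{F}_X$ is the free monoid on $X$ (all finite words over $X$, including the empty word), with $\ell(w)$ the length of $w$; for $w=A_1\cdots A_k\in\mathcal{F}_X$ put $\alpha_X(w)=A_1+\cdots+A_k$ and, for $0\le m\le k$, $\sigma_m(w)=A_1\cdots A_m$. For a submonoid $\mathcal{C}$ of $\mathbb{Z}^2$, define $\mathcal{F}_X^{\mathcal{C}}=\{w\in\mathcal{F}_X:\alpha_X(\sigma_m(w))\in\mathcal{C}\text{ for all }0\le m\le\ell(w)\}$ and $\mathcal{A}_X^{\mathcal{C}}=\alpha_X(\mathcal{F}_X^{\mathcal{C}})$; these are submonoids of $\mathcal{F}_X$ and $\mathbb{Z}^2$ respectively. For $A\in\mathbb{Z}^2$, $\pi_X^{\mathcal{C}}(A)$ is the (possibly infinite) number of $w\in\mathcal{F}_X^{\mathcal{C}}$ with $\alpha_X(w)=A$. $(X,\mathcal{C})$ has the IPP if $\pi_X^{\mathcal{C}}(A)=\infty$ for all $A\in\mathcal{A}_X^{\mathcal{C}}$. $\operatorname{Conv}$ denotes convex hull in $\mathbb{R}^2$. -}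

module Defs where

open import Algebra.Bundles using (RawMonoid)
import Algebra.Definitions.RawMonoid as RawMonoidSum
open import Data.Fin.Base using (Fin)
open import Data.Integer.Base as ℤ using (ℤ; 0ℤ)
open import Data.List.Base using (List; foldr; take; length)
open import Data.List.Relation.Unary.All using (All)
open import Data.Nat.Base as ℕ using (ℕ; _⊔_)
import Data.Nat.Properties as ℕₚ
open import Data.Product.Base using (Σ-syntax; ∃-syntax; _×_; _,_; proj₁; proj₂)
open import Data.Rational.Base as ℚ using (ℚ; 0ℚ; 1ℚ; ½; ∣_∣)
import Data.Rational.Properties as ℚₚ
open import Data.Rational.Solver using (module +-*-Solver)
open import Function.Bundles using (_↣_; Injection)
open import Level using (Level; 0ℓ) renaming (_⊔_ to _⊔ˡ_; suc to lsuc)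
open import Relation.Binary.PropositionalEquality using (_≡_; _≢_; refl; sym; trans; cong; subst)
open import Relation.Unary using (Pred; _∈_; _∉_)

private
  variable
    a c ℓ : Level

-- Real numbers as Cauchy sequences of rationals; equality and order on ℝ are
-- _≃_ and _≤ᴿ_ below.

record ℝ : Set where
  constructor mkℝ
  field
    seq    : ℕ → ℚ
    cauchy : ∀ ε → 0ℚ ℚ.< ε →
             ∃[ N ] (∀ m n → N ℕ.≤ m → N ℕ.≤ n → ∣ seq m ℚ.- seq n ∣ ℚ.< ε)

open ℝ public

infix 4 _≃_ _≤ᴿ_

_≃_ : ℝ → ℝ → Set
x ≃ y = ∀ ε → 0ℚ ℚ.< ε → ∃[ N ] (∀ n → N ℕ.≤ n → ∣ seq x n ℚ.- seq y n ∣ ℚ.< ε)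

_≤ᴿ_ : ℝ → ℝ → Set
x ≤ᴿ y = ∀ ε → 0ℚ ℚ.< ε → ∃[ N ] (∀ n → N ℕ.≤ n → seq x n ℚ.< seq y n ℚ.+ ε)

fromℚ : ℚ → ℝ
fromℚ q = mkℝ (λ _ → q) λ ε 0<ε →
  0 , λ _ _ _ _ → subst (ℚ._< ε) (sym (cong ∣_∣ (ℚₚ.+-inverseʳ q))) 0<ε

0ᴿ 1ᴿ : ℝ
0ᴿ = fromℚ 0ℚ
1ᴿ = fromℚ 1ℚ

infixl 6 _+ᴿ_

_+ᴿ_ : ℝ → ℝ → ℝ
seq (x +ᴿ y) n = seq x n ℚ.+ seq y n
cauchy (x +ᴿ y) ε 0<ε = N₁ ⊔ N₂ , bound
  where
  δ : ℚ
  δ = ½ ℚ.* ε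

  0<δ : 0ℚ ℚ.< δ
  0<δ = subst (ℚ._< δ) (ℚₚ.*-zeroʳ ½) (ℚₚ.*-monoʳ-<-pos ½ 0<ε)

  N₁ N₂ : ℕ
  N₁ = proj₁ (cauchy x δ 0<δ)
  N₂ = proj₁ (cauchy y δ 0<δ)

  rearrange : ∀ p q r s → (p ℚ.+ q) ℚ.- (r ℚ.+ s) ≡ (p ℚ.- r) ℚ.+ (q ℚ.- s)
  rearrange = solve 4 (λ p q r s → (p :+ q) :- (r :+ s) := (p :- r) :+ (q :- s)) refl
    where open +-*-Solver

  halves : δ ℚ.+ δ ≡ ε
  halves = trans (sym (ℚₚ.*-distribʳ-+ ε ½ ½)) (ℚₚ.*-identityˡ ε)

  bound : ∀ m n → N₁ ⊔ N₂ ℕ.≤ m → N₁ ⊔ N₂ ℕ.≤ n →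
          ∣ (seq x m ℚ.+ seq y m) ℚ.- (seq x n ℚ.+ seq y n) ∣ ℚ.< ε
  bound m n N≤m N≤n = begin-strict
    ∣ (seq x m ℚ.+ seq y m) ℚ.- (seq x n ℚ.+ seq y n) ∣
      ≡⟨ cong ∣_∣ (rearrange (seq x m) (seq y m) (seq x n) (seq y n)) ⟩
    ∣ (seq x m ℚ.- seq x n) ℚ.+ (seq y m ℚ.- seq y n) ∣
      ≤⟨ ℚₚ.∣p+q∣≤∣p∣+∣q∣ (seq x m ℚ.- seq x n) (seq y m ℚ.- seq y n) ⟩
    ∣ seq x m ℚ.- seq x n ∣ ℚ.+ ∣ seq y m ℚ.- seq y n ∣
      <⟨ ℚₚ.+-mono-<
           (proj₂ (cauchy x δ 0<δ) m n (ℕₚ.m⊔n≤o⇒m≤o N₁ N₂ N≤m) (ℕₚ.m⊔n≤o⇒m≤o N₁ N₂ N≤n))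
           (proj₂ (cauchy y δ 0<δ) m n (ℕₚ.m⊔n≤o⇒n≤o N₁ N₂ N≤m) (ℕₚ.m⊔n≤o⇒n≤o N₁ N₂ N≤n)) ⟩
    δ ℚ.+ δ
      ≡⟨ halves ⟩
    ε ∎
    where open ℚₚ.≤-Reasoning

infixl 7 _·_

_·_ : ℝ → ℚ → ℝ
seq (x · q) n = seq x n ℚ.* q
cauchy (x · q) ε 0<ε = proj₁ (cauchy x δ 0<δ) , bound
  where
  r : ℚ
  r = ∣ q ∣ ℚ.+ 1ℚ

  instance
    r-pos : ℚ.Positive r
    r-pos = ℚₚ.nonNeg+pos⇒pos ∣ q ∣ {{ℚ.nonNegative (ℚₚ.0≤∣p∣ q)}} 1ℚ

    r-nonZero : ℚ.NonZero r
    r-nonZero = ℚₚ.pos⇒nonZero r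

    1/r-pos : ℚ.Positive (ℚ.1/ r)
    1/r-pos = ℚₚ.1/pos⇒pos r

  δ : ℚ
  δ = ε ℚ.* ℚ.1/ r

  0<δ : 0ℚ ℚ.< δ
  0<δ = subst (ℚ._< δ) (ℚₚ.*-zeroˡ (ℚ.1/ r)) (ℚₚ.*-monoˡ-<-pos (ℚ.1/ r) 0<ε)

  factor : ∀ s t u → s ℚ.* u ℚ.- t ℚ.* u ≡ (s ℚ.- t) ℚ.* u
  factor = solve 3 (λ s t u → s :* u :- t :* u := (s :- t) :* u) refl
    where open +-*-Solver

  ∣q∣≤r : ∣ q ∣ ℚ.≤ r
  ∣q∣≤r = subst (ℚ._≤ r) (ℚₚ.+-identityʳ ∣ q ∣) (ℚₚ.+-monoʳ-≤ ∣ q ∣ (ℚₚ.nonNegative⁻¹ 1ℚ))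

  bound : ∀ m n → proj₁ (cauchy x δ 0<δ) ℕ.≤ m → proj₁ (cauchy x δ 0<δ) ℕ.≤ n →
          ∣ seq x m ℚ.* q ℚ.- seq x n ℚ.* q ∣ ℚ.< ε
  bound m n N≤m N≤n = begin-strict
    ∣ seq x m ℚ.* q ℚ.- seq x n ℚ.* q ∣
      ≡⟨ cong ∣_∣ (factor (seq x m) (seq x n) q) ⟩
    ∣ (seq x m ℚ.- seq x n) ℚ.* q ∣
      ≡⟨ ℚₚ.∣p*q∣≡∣p∣*∣q∣ (seq x m ℚ.- seq x n) q ⟩
    ∣ seq x m ℚ.- seq x n ∣ ℚ.* ∣ q ∣
      ≤⟨ ℚₚ.*-monoˡ-≤-nonNeg ∣ seq x m ℚ.- seq x n ∣
           {{ℚ.nonNegative (ℚₚ.0≤∣p∣ (seq x m ℚ.- seq x n))}} ∣q∣≤r ⟩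
    ∣ seq x m ℚ.- seq x n ∣ ℚ.* r
      <⟨ ℚₚ.*-monoˡ-<-pos r (proj₂ (cauchy x δ 0<δ) m n N≤m N≤n) ⟩
    ε ℚ.* ℚ.1/ r ℚ.* r
      ≡⟨ trans (ℚₚ.*-assoc ε (ℚ.1/ r) r) (cong (ε ℚ.*_) (ℚₚ.*-inverseˡ r)) ⟩
    ε ℚ.* 1ℚ
      ≡⟨ ℚₚ.*-identityʳ ε ⟩
    ε ∎
    where open ℚₚ.≤-Reasoning

+ᴿ-rawMonoid : RawMonoid 0ℓ 0ℓ
+ᴿ-rawMonoid = record { Carrier = ℝ ; _≈_ = _≃_ ; _∙_ = _+ᴿ_ ; ε = 0ᴿ }

open RawMonoidSum +ᴿ-rawMonoid public using () renaming (sum to ∑)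

ℝ² : Set
ℝ² = ℝ × ℝ

ℤ² : Set
ℤ² = ℤ × ℤ

O : ℤ²
O = 0ℤ , 0ℤ

infixl 6 _⊕_

_⊕_ : ℤ² → ℤ² → ℤ²
(i , j) ⊕ (k , l) = i ℤ.+ k , j ℤ.+ l

fromℤ : ℤ → ℝ
fromℤ i = fromℚ (i ℚ./ 1)

ι : ℤ² → ℝ²
ι (i , j) = fromℤ i , fromℤ j

-- The convex hull in ℝ² of a set of lattice points: all finite real convex
-- combinations of points of the set.  The condition ∑ λᵢ ≃ 1 excludes k = 0.
Conv : Pred ℤ² ℓ → Pred ℝ² ℓ
Conv P (x , y) =
  Σ[ k ∈ ℕ ] Σ[ A ∈ (Fin k → ℤ²) ] Σ[ coeff ∈ (Fin k → ℝ) ]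
    (∀ i → A i ∈ P) ×
    (∀ i → 0ᴿ ≤ᴿ coeff i) ×
    ∑ coeff ≃ 1ᴿ ×
    ∑ (λ i → coeff i · (proj₁ (A i) ℚ./ 1)) ≃ x ×
    ∑ (λ i → coeff i · (proj₂ (A i) ℚ./ 1)) ≃ y

record StepSet (a : Level) : Set (lsuc a) where
  field
    Step   : Pred ℤ² a
    O∉Step : O ∉ Step

open StepSet public

record Submonoid (c : Level) : Set (lsuc c) where
  field
    Mem      : Pred ℤ² c
    O∈Mem    : O ∈ Mem
    ⊕-closed : ∀ {A B} → A ∈ Mem → B ∈ Mem → A ⊕ B ∈ Mem

open Submonoid public

-- Words are bare lists of lattice points, with membership of the letters in X
-- kept as a separate predicate, so that words are compared by their letters
-- only and not by the proofs of membership.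
Word : Set
Word = List ℤ²

α : Word → ℤ²
α = foldr _⊕_ O

σ : ℕ → Word → Word
σ = take

ℱ : StepSet a → Pred Word a
ℱ X = All (Step X)

ℱ[_,_] : StepSet a → Submonoid c → Pred Word (a ⊔ˡ c)
ℱ[ X , C ] w = w ∈ ℱ X × (∀ m → m ℕ.≤ length w → α (σ m w) ∈ Mem C)

paths : StepSet a → Submonoid c → ℤ² → Pred Word (a ⊔ˡ c)
paths X C A w = w ∈ ℱ[ X , C ] × α w ≡ A

𝒜[_,_] : StepSet a → Submonoid c → Pred ℤ² (a ⊔ˡ c)
𝒜[ X , C ] A = ∃[ w ] (w ∈ paths X C A)

-- Infinitude in the positive (Dedekind) sense: an injective sequence in P.
Infinite : {S : Set} → Pred S ℓ → Set ℓ
Infinite {S = S} P = Σ[ f ∈ ℕ ↣ S ] (∀ n → Injection.to f n ∈ P)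

IPP : StepSet a → Submonoid c → Set (a ⊔ˡ c)
IPP X C = ∀ A → A ∈ 𝒜[ X , C ] → Infinite (paths X C A)

_∖O : Pred ℤ² ℓ → Pred ℤ² ℓ
(P ∖O) A = A ∈ P × A ≢ O

HasNontrivialUnits : Pred ℤ² ℓ → Set ℓ
HasNontrivialUnits M = ∃[ U ] (U ∈ M × U ≢ O × ∃[ V ] (V ∈ M × U ⊕ V ≡ O))

{-# OPTIONS --safe #-}

-- (iii) ⇒ (iv) is Gordan's alternative in the plane: finitely many nonzero
-- elements of a submonoid S of ℤ² either exhibit a unit of S or are all
-- positive for one integral linear functional f.  In the second case a convex
-- combination ∑ cᵢ Aᵢ satisfies f (∑ cᵢ Aᵢ) = ∑ cᵢ f (Aᵢ) ≥ ∑ cᵢ = 1, so it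
-- is not O.  Conversely, a nonempty word with sum O is a convex combination
-- with equal weights, and when its prefix sums stay in C it can be prepended
-- to any path arbitrarily often.  The counterexamples use the steps (±1 , 0),
-- with C the half-line {(i , 0) : i ≥ 0} for (i) and C = {O} for (ii).
module Submission where

open import Algebra.Properties.Group using (⁻¹-involutive)
import Algebra.Definitions.RawMonoid as RawMonoidSum
open import Defs
open import Data.Empty using (⊥; ⊥-elim)
open import Data.Fin.Base using (Fin; zero; suc)
open import Data.Fin.Properties using (any?)
open import Data.Integer.Base as ℤ using (ℤ; +_; -[1+_]; +[1+_]; 0ℤ; 1ℤ)
import Data.Integer.Properties as ℤₚ
open import Data.Integer.Tactic.RingSolver using (solve-∀)
open import Data.List.Base using ([]; _∷_; _++_; take; length; lookup)
open import Data.List.Properties using (length-++; take-all; ++-conicalˡ)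
open import Data.List.Relation.Unary.All as All using (All; []; _∷_)
open import Data.List.Relation.Unary.All.Properties using (++⁺)
open import Data.List.Membership.Propositional.Properties using (∈-lookup)
open import Data.Nat.Base as ℕ using (ℕ; zero; suc; _⊔_)
import Data.Nat.Properties as ℕₚ
open import Data.Product.Base using (∃-syntax; _×_; _,_; proj₁; proj₂)
open import Data.Rational.Base as ℚ using (ℚ; 0ℚ; 1ℚ; ½; ∣_∣)
import Data.Rational.Properties as ℚₚ
open import Data.Rational.Solver using (module +-*-Solver)
open import Data.Rational.Unnormalised.Base as ℚᵘ using (mkℚᵘ; *≡*)
import Data.Rational.Unnormalised.Properties as ℚᵘₚ
open import Data.Sum.Base using (_⊎_; inj₁; inj₂; [_,_]′)
open import Function.Base using (_∘_; id)
open import Function.Bundles using (_⇔_; mk⇔; mk↣; Injection)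
open import Level using (Level; Lift; lift; lower) renaming (_⊔_ to _⊔ˡ_)
open import Relation.Binary.PropositionalEquality
  using (_≡_; _≢_; refl; sym; trans; cong; cong₂; subst; module ≡-Reasoning)
open import Relation.Nullary.Decidable using (yes; no)
open import Relation.Nullary.Negation using (¬_)
open import Relation.Unary using (Pred; _∈_)

open RawMonoidSum ℤ.+-0-rawMonoid using () renaming (sum to ∑ℤ)

private
  variable
    a c ℓ : Level

-- Gordan's alternative in ℤ²

infixl 7 _•_

_•_ : ℤ → ℤ² → ℤ²
n • (i , j) = n ℤ.* i , n ℤ.* j

dot : ℤ² → ℤ² → ℤ
dot (p , q) (i , j) = p ℤ.* i ℤ.+ q ℤ.* j

-- dot (rot B) A is the determinant of (A , B).
rot : ℤ² → ℤ²
rot (i , j) = j , ℤ.- i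

⊕-identityˡ : ∀ A → O ⊕ A ≡ A
⊕-identityˡ (i , j) = cong₂ _,_ (ℤₚ.+-identityˡ i) (ℤₚ.+-identityˡ j)

⊕-identityʳ : ∀ A → A ⊕ O ≡ A
⊕-identityʳ (i , j) = cong₂ _,_ (ℤₚ.+-identityʳ i) (ℤₚ.+-identityʳ j)

⊕-assoc : ∀ A B C → (A ⊕ B) ⊕ C ≡ A ⊕ (B ⊕ C)
⊕-assoc (i , j) (k , l) (m , n) = cong₂ _,_ (ℤₚ.+-assoc i k m) (ℤₚ.+-assoc j l n)

•-zeroˡ : ∀ A → 0ℤ • A ≡ O
•-zeroˡ (i , j) = cong₂ _,_ (ℤₚ.*-zeroˡ i) (ℤₚ.*-zeroˡ j)

•-suc : ∀ n A → ℤ.suc n • A ≡ A ⊕ n • A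
•-suc n (i , j) = cong₂ _,_ (ℤₚ.suc-* n i) (ℤₚ.suc-* n j)

•-closed : (S : Submonoid ℓ) {n : ℤ} {A : ℤ²} → 0ℤ ℤ.≤ n → A ∈ Mem S → n • A ∈ Mem S
•-closed S {+ n} {A} (ℤ.+≤+ _) A∈S = natural n
  where
  natural : ∀ n → + n • A ∈ Mem S
  natural zero    = subst (_∈ Mem S) (sym (•-zeroˡ A)) (O∈Mem S)
  natural (suc n) = subst (_∈ Mem S) (sym (•-suc (+ n) A)) (⊕-closed S A∈S (natural n))

-- No division by `u` is needed: since `u` is at least 1, the inverse of `B` is `(u - 1) • B ⊕ V`,
-- which already lies in `S`.
dependency⇒units : (S : Submonoid ℓ) {u : ℤ} {B V : ℤ²} → 0ℤ ℤ.< u →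
                   B ∈ Mem S → B ≢ O → V ∈ Mem S → u • B ⊕ V ≡ O →
                   HasNontrivialUnits (Mem S)
dependency⇒units S {+[1+ n ]} {B} {V} _ B∈S B≢O V∈S uB⊕V≡O =
  B , B∈S , B≢O , + n • B ⊕ V , ⊕-closed S (•-closed S {+ n} (ℤ.+≤+ ℕ.z≤n) B∈S) V∈S ,
  trans (sym (⊕-assoc B (+ n • B) V)) (trans (cong (_⊕ V) (sym (•-suc (+ n) B))) uB⊕V≡O)
dependency⇒units S {+ 0} (ℤ.+<+ ())

0≤neg : ∀ {i} → i ℤ.≤ 0ℤ → 0ℤ ℤ.≤ ℤ.- i
0≤neg = ℤₚ.neg-mono-≤

0<neg : ∀ {i} → i ℤ.< 0ℤ → 0ℤ ℤ.< ℤ.- i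
0<neg = ℤₚ.neg-mono-<

*-0< : ∀ {i j} → 0ℤ ℤ.< i → 0ℤ ℤ.< j → 0ℤ ℤ.< i ℤ.* j
*-0< {+[1+ _ ]} {+[1+ _ ]} _ _ = ℤ.+<+ ℕ.z<s
*-0< {+ 0}      (ℤ.+<+ ())
*-0< {+[1+ _ ]} {+ 0} _ (ℤ.+<+ ())

*-0≤ : ∀ {i j} → 0ℤ ℤ.≤ i → 0ℤ ℤ.≤ j → 0ℤ ℤ.≤ i ℤ.* j
*-0≤ {+ m} {+ n} _ _ = subst (0ℤ ℤ.≤_) (ℤₚ.pos-* m n) (ℤ.+≤+ ℕ.z≤n)

0≤square : ∀ i → 0ℤ ℤ.≤ i ℤ.* i
0≤square (+ n)    = *-0≤ {+ n} {+ n} (ℤ.+≤+ ℕ.z≤n) (ℤ.+≤+ ℕ.z≤n)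
0≤square -[1+ n ] = ℤ.+≤+ ℕ.z≤n

0<square : ∀ i → i ≢ 0ℤ → 0ℤ ℤ.< i ℤ.* i
0<square (+ 0)    i≢0 = ⊥-elim (i≢0 refl)
0<square +[1+ n ] _   = ℤ.+<+ ℕ.z<s
0<square -[1+ n ] _   = ℤ.+<+ ℕ.z<s

0<dot-self : ∀ A → A ≢ O → 0ℤ ℤ.< dot A A
0<dot-self (i , j) A≢O with i ℤₚ.≟ 0ℤ
... | no  i≢0  = ℤₚ.+-mono-<-≤ (0<square i i≢0) (0≤square j)
... | yes refl = ℤₚ.+-mono-≤-< (0≤square i) (0<square j (A≢O ∘ cong (0ℤ ,_)))

dot-• : ∀ n B A → dot (n • rot B ⊕ B) A ≡ n ℤ.* dot (rot B) A ℤ.+ dot B A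
dot-• n (i , j) (k , l) = identity n i j k l
  where
  identity : ∀ n i j k l →
    (n ℤ.* j ℤ.+ i) ℤ.* k ℤ.+ (n ℤ.* (ℤ.- i) ℤ.+ j) ℤ.* l ≡
    n ℤ.* (j ℤ.* k ℤ.+ (ℤ.- i) ℤ.* l) ℤ.+ (i ℤ.* k ℤ.+ j ℤ.* l)
  identity = solve-∀

-- The term `n • rot B` vanishes at `B` because det (B , B) = 0, so `n` can be chosen freely without
-- affecting positivity at `B`.
dot-•-self : ∀ n B → dot (n • rot B ⊕ B) B ≡ dot B B
dot-•-self n (i , j) = identity n i j
  where
  identity : ∀ n i j →
    (n ℤ.* j ℤ.+ i) ℤ.* i ℤ.+ (n ℤ.* (ℤ.- i) ℤ.+ j) ℤ.* j ≡ i ℤ.* i ℤ.+ j ℤ.* j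
  identity = solve-∀

-- f(A) B − f(B) A lies in the kernel of f, hence is a multiple of (−q , p).
elimination : ∀ p q A B → let f = p , q in
  dot f A • B ⊕ (ℤ.- dot f B) • A ≡ dot (rot B) A • (ℤ.- q , p)
elimination p q (k , l) (i , j) = cong₂ _,_ (first p q i j k l) (second p q i j k l)
  where
  first : ∀ p q i j k l →
    (p ℤ.* k ℤ.+ q ℤ.* l) ℤ.* i ℤ.+ (ℤ.- (p ℤ.* i ℤ.+ q ℤ.* j)) ℤ.* k ≡
    (j ℤ.* k ℤ.+ (ℤ.- i) ℤ.* l) ℤ.* (ℤ.- q)
  first = solve-∀
  second : ∀ p q i j k l →
    (p ℤ.* k ℤ.+ q ℤ.* l) ℤ.* j ℤ.+ (ℤ.- (p ℤ.* i ℤ.+ q ℤ.* j)) ℤ.* l ≡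
    (j ℤ.* k ℤ.+ (ℤ.- i) ℤ.* l) ℤ.* p
  second = solve-∀

-- Combines the eliminations of A₁ and A₂ so that the right-hand sides cancel.
elimination₂ : ∀ f A₁ A₂ B → let s = dot (rot B) A₁ ; t = ℤ.- dot (rot B) A₂ ; g = ℤ.- dot f B in
  (s ℤ.* dot f A₂ ℤ.+ t ℤ.* dot f A₁) • B ⊕ ((s ℤ.* g) • A₂ ⊕ (t ℤ.* g) • A₁) ≡ O
elimination₂ (p , q) (k , l) (m , n) (i , j) =
  cong₂ _,_ (first p q i j k l m n) (second p q i j k l m n)
  where
  first : ∀ p q i j k l m n →
    let s = j ℤ.* k ℤ.+ (ℤ.- i) ℤ.* l
        t = ℤ.- (j ℤ.* m ℤ.+ (ℤ.- i) ℤ.* n)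
        g = ℤ.- (p ℤ.* i ℤ.+ q ℤ.* j)
    in (s ℤ.* (p ℤ.* m ℤ.+ q ℤ.* n) ℤ.+ t ℤ.* (p ℤ.* k ℤ.+ q ℤ.* l)) ℤ.* i ℤ.+
       ((s ℤ.* g) ℤ.* m ℤ.+ (t ℤ.* g) ℤ.* k) ≡ 0ℤ
  first = solve-∀
  second : ∀ p q i j k l m n →
    let s = j ℤ.* k ℤ.+ (ℤ.- i) ℤ.* l
        t = ℤ.- (j ℤ.* m ℤ.+ (ℤ.- i) ℤ.* n)
        g = ℤ.- (p ℤ.* i ℤ.+ q ℤ.* j)
    in (s ℤ.* (p ℤ.* m ℤ.+ q ℤ.* n) ℤ.+ t ℤ.* (p ℤ.* k ℤ.+ q ℤ.* l)) ℤ.* j ℤ.+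
       ((s ℤ.* g) ℤ.* n ℤ.+ (t ℤ.* g) ℤ.* l) ≡ 0ℤ
  second = solve-∀

-- A zero determinant kills the right-hand side of `elimination`, which leaves f(A) B + (-f(B)) A =
-- O with a positive coefficient at `B` and a nonnegative one at `A`.
parallel⇒units : (S : Submonoid ℓ) (f : ℤ²) {A B : ℤ²} → A ∈ Mem S → B ∈ Mem S → B ≢ O →
                 0ℤ ℤ.< dot f A → dot f B ℤ.≤ 0ℤ → dot (rot B) A ≡ 0ℤ →
                 HasNontrivialUnits (Mem S)
parallel⇒units S (p , q) {A} {B} A∈S B∈S B≢O 0<fA fB≤0 det≡0 =
  dependency⇒units S 0<fA B∈S B≢O (•-closed S (0≤neg fB≤0) A∈S)
    (trans (elimination p q A B) (trans (cong (_• (ℤ.- q , p)) det≡0) (•-zeroˡ (ℤ.- q , p))))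

-- Opposite signs of the determinants make both multipliers `s` and `t` of `elimination₂` positive.
-- Hence the coefficient of `B` is positive and those of `A₁` and `A₂` are nonnegative.
straddling⇒units : (S : Submonoid ℓ) (f : ℤ²) {A₁ A₂ B : ℤ²} →
                   A₁ ∈ Mem S → A₂ ∈ Mem S → B ∈ Mem S → B ≢ O →
                   0ℤ ℤ.< dot f A₁ → 0ℤ ℤ.< dot f A₂ → dot f B ℤ.≤ 0ℤ →
                   0ℤ ℤ.< dot (rot B) A₁ → dot (rot B) A₂ ℤ.< 0ℤ →
                   HasNontrivialUnits (Mem S)
straddling⇒units S f {A₁} {A₂} {B} A₁∈S A₂∈S B∈S B≢O 0<fA₁ 0<fA₂ fB≤0 0<det₁ det₂<0 =
  dependency⇒units S (ℤₚ.+-mono-< (*-0< 0<det₁ 0<fA₂) (*-0< (0<neg det₂<0) 0<fA₁)) B∈S B≢O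
    (⊕-closed S (•-closed S (*-0≤ (ℤₚ.<⇒≤ 0<det₁) (0≤neg fB≤0)) A₂∈S)
                (•-closed S (*-0≤ (ℤₚ.<⇒≤ (0<neg det₂<0)) (0≤neg fB≤0)) A₁∈S))
    (elimination₂ f A₁ A₂ B)

upperBound : ∀ {k} (e : Fin k → ℤ) → ∃[ n ] (0ℤ ℤ.≤ n × ∀ i → e i ℤ.< n)
upperBound {zero}  e = 0ℤ , ℤₚ.≤-refl , λ ()
upperBound {suc k} e with upperBound (e ∘ suc)
... | n , 0≤n , e<n = n ℤ.⊔ ℤ.suc (e zero) , ℤₚ.≤-trans 0≤n (ℤₚ.i≤i⊔j n _) , λ
  { zero    → ℤₚ.<-≤-trans (ℤₚ.suc[i]≤j⇒i<j ℤₚ.≤-refl) (ℤₚ.i≤j⊔i n _)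
  ; (suc i) → ℤₚ.<-≤-trans (e<n i) (ℤₚ.i≤i⊔j n _) }

-- Positive integers are at least 1, so any nonnegative `n` above all `- e i` satisfies n dᵢ ≥ n >
-- -eᵢ.
dominate : ∀ {k} (d e : Fin k → ℤ) → (∀ i → 0ℤ ℤ.< d i) →
           ∃[ n ] (∀ i → 0ℤ ℤ.< n ℤ.* d i ℤ.+ e i)
dominate d e 0<d with upperBound (ℤ.-_ ∘ e)
... | n , 0≤n , -e<n = n , λ i →
  subst (ℤ._< n ℤ.* d i ℤ.+ e i) (ℤₚ.+-inverseˡ (e i))
    (ℤₚ.+-monoˡ-< (e i) (ℤₚ.<-≤-trans (-e<n i)
      (subst (ℤ._≤ n ℤ.* d i) (ℤₚ.*-identityʳ n)
        (ℤₚ.*-monoˡ-≤-nonNeg n {{ℤ.nonNegative 0≤n}} (ℤₚ.i<j⇒suc[i]≤j (0<d i))))))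

dominate± : ∀ {k} (d e : Fin k → ℤ) → (∀ i → 0ℤ ℤ.< d i) ⊎ (∀ i → d i ℤ.< 0ℤ) →
            ∃[ n ] (∀ i → 0ℤ ℤ.< n ℤ.* d i ℤ.+ e i)
dominate± d e (inj₁ 0<d) = dominate d e 0<d
dominate± d e (inj₂ d<0) with dominate (ℤ.-_ ∘ d) e (λ i → 0<neg (d<0 i))
... | n , 0<nd+e = ℤ.- n , λ i →
  subst (λ x → 0ℤ ℤ.< x ℤ.+ e i) (negate n (d i)) (0<nd+e i)
  where
  negate : ∀ n m → n ℤ.* (ℤ.- m) ≡ (ℤ.- n) ℤ.* m
  negate = solve-∀

signs : ∀ {k} (d : Fin k → ℤ) →
        (∃[ i ] d i ≡ 0ℤ) ⊎
        (∃[ i ] ∃[ j ] (0ℤ ℤ.< d i × d j ℤ.< 0ℤ)) ⊎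
        ((∀ i → 0ℤ ℤ.< d i) ⊎ (∀ i → d i ℤ.< 0ℤ))
signs d with any? (λ i → d i ℤₚ.≟ 0ℤ)
... | yes d≡0 = inj₁ d≡0
... | no  d≢0 with any? (λ i → 0ℤ ℤₚ.<? d i) | any? (λ i → d i ℤₚ.<? 0ℤ)
...   | yes (i , 0<di) | yes (j , dj<0) = inj₂ (inj₁ (i , j , 0<di , dj<0))
...   | no  0≮d        | _              = inj₂ (inj₂ (inj₂ λ i →
        ℤₚ.≤∧≢⇒< (ℤₚ.≮⇒≥ (λ 0<di → 0≮d (i , 0<di))) (λ di≡0 → d≢0 (i , di≡0))))
...   | _              | no  d≮0        = inj₂ (inj₂ (inj₁ λ i →
        ℤₚ.≤∧≢⇒< (ℤₚ.≮⇒≥ (λ di<0 → d≮0 (i , di<0))) (λ 0≡di → d≢0 (i , sym 0≡di))))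

-- When a new point B is not positive under f, the signs of det (Aᵢ , B) decide:
-- if they are all equal, a large multiple of det (- , B) perturbed by
-- dot B is positive on every point; otherwise the eliminations give −B ∈ S.
gordan : (S : Submonoid ℓ) → ∀ {k} (A : Fin k → ℤ²) → (∀ i → A i ∈ Mem S × A i ≢ O) →
         HasNontrivialUnits (Mem S) ⊎ ∃[ f ] (∀ i → 0ℤ ℤ.< dot f (A i))
gordan S {zero}  A A∈S = inj₂ (O , λ ())
gordan S {suc k} A A∈S with gordan S (A ∘ suc) (A∈S ∘ suc)
... | inj₁ units = inj₁ units
... | inj₂ (f , 0<fA) with 0ℤ ℤₚ.<? dot f (A zero)
...   | yes 0<fB = inj₂ (f , λ { zero → 0<fB ; (suc i) → 0<fA i })
...   | no  0≮fB with signs (dot (rot (A zero)) ∘ A ∘ suc)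
...     | inj₁ (i , det≡0) = inj₁ (parallel⇒units S f
            (proj₁ (A∈S (suc i))) (proj₁ (A∈S zero)) (proj₂ (A∈S zero))
            (0<fA i) (ℤₚ.≮⇒≥ 0≮fB) det≡0)
...     | inj₂ (inj₁ (i , j , 0<det , det<0)) = inj₁ (straddling⇒units S f
            (proj₁ (A∈S (suc i))) (proj₁ (A∈S (suc j))) (proj₁ (A∈S zero)) (proj₂ (A∈S zero))
            (0<fA i) (0<fA j) (ℤₚ.≮⇒≥ 0≮fB) 0<det det<0)
...     | inj₂ (inj₂ sameSign)
          with dominate± (dot (rot (A zero)) ∘ A ∘ suc) (dot (A zero) ∘ A ∘ suc) sameSign
...       | n , 0<h = inj₂ (n • rot (A zero) ⊕ A zero , λ
            { zero    → subst (0ℤ ℤ.<_) (sym (dot-•-self n (A zero)))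
                          (0<dot-self (A zero) (proj₂ (A∈S zero)))
            ; (suc i) → subst (0ℤ ℤ.<_) (sym (dot-• n (A zero) (A (suc i)))) (0<h i) })

-- Asymptotic inequalities between rational sequences

toℚ : ℤ → ℚ
toℚ i = i ℚ./ 1

-- For a variable numerator `i ℚ./ 1` is stuck on its gcd normalisation; in the unnormalised
-- rationals the claim becomes an integer ring identity.
toℚ-+ : ∀ i j → toℚ (i ℤ.+ j) ≡ toℚ i ℚ.+ toℚ j
toℚ-+ i j = ℚₚ.toℚᵘ-injective (begin
  ℚ.toℚᵘ (toℚ (i ℤ.+ j))                   ≈⟨ ℚₚ.toℚᵘ-fromℚᵘ (mkℚᵘ (i ℤ.+ j) 0) ⟩
  mkℚᵘ (i ℤ.+ j) 0                         ≈⟨ *≡* (unitDenominators i j) ⟩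
  mkℚᵘ i 0 ℚᵘ.+ mkℚᵘ j 0                   ≈⟨ ℚᵘₚ.+-cong (ℚₚ.toℚᵘ-fromℚᵘ (mkℚᵘ i 0)) (ℚₚ.toℚᵘ-fromℚᵘ (mkℚᵘ j 0)) ⟨
  ℚ.toℚᵘ (toℚ i) ℚᵘ.+ ℚ.toℚᵘ (toℚ j)       ≈⟨ ℚₚ.toℚᵘ-homo-+ (toℚ i) (toℚ j) ⟨
  ℚ.toℚᵘ (toℚ i ℚ.+ toℚ j)                 ∎)
  where
  open import Relation.Binary.Reasoning.Setoid ℚᵘₚ.≃-setoid
  unitDenominators : ∀ i j → (i ℤ.+ j) ℤ.* 1ℤ ≡ (i ℤ.* 1ℤ ℤ.+ j ℤ.* 1ℤ) ℤ.* 1ℤ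
  unitDenominators = solve-∀

toℚ-* : ∀ i j → toℚ (i ℤ.* j) ≡ toℚ i ℚ.* toℚ j
toℚ-* i j = ℚₚ.toℚᵘ-injective (begin
  ℚ.toℚᵘ (toℚ (i ℤ.* j))                   ≈⟨ ℚₚ.toℚᵘ-fromℚᵘ (mkℚᵘ (i ℤ.* j) 0) ⟩
  mkℚᵘ i 0 ℚᵘ.* mkℚᵘ j 0                   ≈⟨ ℚᵘₚ.*-cong (ℚₚ.toℚᵘ-fromℚᵘ (mkℚᵘ i 0)) (ℚₚ.toℚᵘ-fromℚᵘ (mkℚᵘ j 0)) ⟨
  ℚ.toℚᵘ (toℚ i) ℚᵘ.* ℚ.toℚᵘ (toℚ j)       ≈⟨ ℚₚ.toℚᵘ-homo-* (toℚ i) (toℚ j) ⟨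
  ℚ.toℚᵘ (toℚ i ℚ.* toℚ j)                 ∎)
  where open import Relation.Binary.Reasoning.Setoid ℚᵘₚ.≃-setoid

-- 0 ≤ lim inf s; for s = seq x the field is 0ᴿ ≤ᴿ x.
record AsymptoticallyNonneg (s : ℕ → ℚ) : Set where
  constructor asymptotically
  field
    bound : ∀ ε → 0ℚ ℚ.< ε → ∃[ N ] (∀ n → N ℕ.≤ n → 0ℚ ℚ.< s n ℚ.+ ε)

open AsymptoticallyNonneg

module _ {s t : ℕ → ℚ} where

  nonneg-resp : (∀ n → s n ≡ t n) → AsymptoticallyNonneg s → AsymptoticallyNonneg t
  bound (nonneg-resp s≡t s≥0) ε 0<ε with bound s≥0 ε 0<ε
  ... | N , s-bound = N , λ n N≤n → subst (λ x → 0ℚ ℚ.< x ℚ.+ ε) (s≡t n) (s-bound n N≤n)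

  nonneg-+ : AsymptoticallyNonneg s → AsymptoticallyNonneg t →
             AsymptoticallyNonneg (λ n → s n ℚ.+ t n)
  bound (nonneg-+ s≥0 t≥0) ε 0<ε with bound s≥0 (½ ℚ.* ε) 0<½ε | bound t≥0 (½ ℚ.* ε) 0<½ε
    where
    0<½ε : 0ℚ ℚ.< ½ ℚ.* ε
    0<½ε = subst (ℚ._< ½ ℚ.* ε) (ℚₚ.*-zeroʳ ½) (ℚₚ.*-monoʳ-<-pos ½ 0<ε)
  ... | M , s-bound | N , t-bound = M ⊔ N , λ n M⊔N≤n →
    subst (0ℚ ℚ.<_) (halves (s n) (t n) ε)
      (ℚₚ.+-mono-< (s-bound n (ℕₚ.m⊔n≤o⇒m≤o M N M⊔N≤n))
                   (t-bound n (ℕₚ.m⊔n≤o⇒n≤o M N M⊔N≤n)))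
    where
    open +-*-Solver
    halves : ∀ x y ε → (x ℚ.+ ½ ℚ.* ε) ℚ.+ (y ℚ.+ ½ ℚ.* ε) ≡ (x ℚ.+ y) ℚ.+ ε
    halves = solve 3 (λ x y ε → (x :+ con ½ :* ε) :+ (y :+ con ½ :* ε) := (x :+ y) :+ ε) refl

nonneg-zero : AsymptoticallyNonneg (λ _ → 0ℚ)
bound nonneg-zero ε 0<ε = 0 , λ _ _ → subst (0ℚ ℚ.<_) (sym (ℚₚ.+-identityˡ ε)) 0<ε

-- Multiplication is unrolled into repeated addition, so that `nonneg-+` does all the work on ε.
nonneg-*ℕ : ∀ {s} w → AsymptoticallyNonneg s → AsymptoticallyNonneg (λ n → s n ℚ.* toℚ (+ w))
nonneg-*ℕ {s} zero    s≥0 = nonneg-resp (λ n → sym (ℚₚ.*-zeroʳ (s n))) nonneg-zero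
nonneg-*ℕ {s} (suc w) s≥0 =
  nonneg-resp (λ n → sym (step (s n))) (nonneg-+ s≥0 (nonneg-*ℕ w s≥0))
  where
  step : ∀ x → x ℚ.* toℚ (+ suc w) ≡ x ℚ.+ x ℚ.* toℚ (+ w)
  step x = begin
    x ℚ.* toℚ (+ suc w)            ≡⟨ cong (x ℚ.*_) (toℚ-+ 1ℤ (+ w)) ⟩
    x ℚ.* (1ℚ ℚ.+ toℚ (+ w))       ≡⟨ ℚₚ.*-distribˡ-+ x 1ℚ (toℚ (+ w)) ⟩
    x ℚ.* 1ℚ ℚ.+ x ℚ.* toℚ (+ w)   ≡⟨ cong (ℚ._+ x ℚ.* toℚ (+ w)) (ℚₚ.*-identityʳ x) ⟩
    x ℚ.+ x ℚ.* toℚ (+ w)          ∎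
    where open ≡-Reasoning

-- The two hypotheses together say that `s` tends to 0, which is why a factor of either sign is
-- allowed.
nonneg-*ℤ : ∀ {s} i → AsymptoticallyNonneg s → AsymptoticallyNonneg (ℚ.-_ ∘ s) →
            AsymptoticallyNonneg (λ n → s n ℚ.* toℚ i)
nonneg-*ℤ     (+ w)    s≥0 _    = nonneg-*ℕ w s≥0
nonneg-*ℤ {s} -[1+ w ] _   -s≥0 =
  nonneg-resp (λ n → negate (s n) (toℚ (+ suc w))) (nonneg-*ℕ (suc w) -s≥0)
  where
  open +-*-Solver
  negate : ∀ x y → (ℚ.- x) ℚ.* y ≡ x ℚ.* (ℚ.- y)
  negate = solve 2 (λ x y → (:- x) :* y := x :* (:- y)) refl

p≤∣p∣ : ∀ p → p ℚ.≤ ∣ p ∣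
p≤∣p∣ p with ℚₚ.≤-total 0ℚ p
... | inj₁ 0≤p = ℚₚ.≤-reflexive (sym (ℚₚ.0≤p⇒∣p∣≡p 0≤p))
... | inj₂ p≤0 = ℚₚ.≤-trans p≤0 (ℚₚ.0≤∣p∣ p)

∣p∣<ε⇒0<p+ε : ∀ {p ε} → ∣ p ∣ ℚ.< ε → 0ℚ ℚ.< p ℚ.+ ε
∣p∣<ε⇒0<p+ε {p} {ε} ∣p∣<ε = subst (ℚ._< p ℚ.+ ε) (ℚₚ.+-inverseʳ p)
  (ℚₚ.+-monoʳ-< p (ℚₚ.≤-<-trans (p≤∣p∣ (ℚ.- p)) (subst (ℚ._< ε) (sym (ℚₚ.∣-p∣≡∣p∣ p)) ∣p∣<ε)))

module _ (x y : ℝ) (x≃y : x ≃ y) where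

  ≃⇒nonneg : AsymptoticallyNonneg (λ n → seq x n ℚ.- seq y n)
  bound ≃⇒nonneg ε 0<ε with x≃y ε 0<ε
  ... | N , ∣x-y∣<ε = N , λ n N≤n → ∣p∣<ε⇒0<p+ε (∣x-y∣<ε n N≤n)

  ≃⇒nonpos : AsymptoticallyNonneg (λ n → ℚ.- (seq x n ℚ.- seq y n))
  bound ≃⇒nonpos ε 0<ε with x≃y ε 0<ε
  ... | N , ∣x-y∣<ε = N , λ n N≤n →
    ∣p∣<ε⇒0<p+ε (subst (ℚ._< ε) (sym (ℚₚ.∣-p∣≡∣p∣ (seq x n ℚ.- seq y n))) (∣x-y∣<ε n N≤n))

-- The negated difference is the form in which the coordinate sums cancel against `∑-dot`.
≃⇒negated-*ℤ : ∀ x y i → x ≃ y →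
               AsymptoticallyNonneg (λ n → (ℚ.- (seq x n ℚ.- seq y n)) ℚ.* toℚ i)
≃⇒negated-*ℤ x y i x≃y = nonneg-*ℤ i (≃⇒nonpos x y x≃y)
  (nonneg-resp (λ n → sym (⁻¹-involutive ℚₚ.+-0-group (seq x n ℚ.- seq y n))) (≃⇒nonneg x y x≃y))

∑-nonneg : ∀ {k} (coeff : Fin k → ℝ) (w : Fin k → ℕ) → (∀ i → 0ᴿ ≤ᴿ coeff i) →
           AsymptoticallyNonneg (seq (∑ (λ i → coeff i · toℚ (+ w i))))
∑-nonneg {zero}  coeff w 0≤coeff = nonneg-zero
∑-nonneg {suc k} coeff w 0≤coeff =
  nonneg-+ (nonneg-*ℕ {seq (coeff zero)} (w zero) (asymptotically (0≤coeff zero)))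
           (∑-nonneg (coeff ∘ suc) (w ∘ suc) (0≤coeff ∘ suc))

-- Here `w i` is the excess f(Aᵢ) - 1, so by linearity of `f` both sides are ∑ cᵢ f(Aᵢ) - ∑ cᵢ. The
-- identity is exact at each index `n` of the Cauchy sequences, with no limit involved.
∑-dot : ∀ {k} (coeff : Fin k → ℝ) (A : Fin k → ℤ²) (w : Fin k → ℕ) (f : ℤ²) →
        (∀ i → dot f (A i) ≡ +[1+ w i ]) → ∀ n →
        seq (∑ (λ i → coeff i · toℚ (+ w i))) n ≡
        seq (∑ (λ i → coeff i · (proj₁ (A i) ℚ./ 1))) n ℚ.* toℚ (proj₁ f) ℚ.+
        seq (∑ (λ i → coeff i · (proj₂ (A i) ℚ./ 1))) n ℚ.* toℚ (proj₂ f) ℚ.-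
        seq (∑ coeff) n
∑-dot {zero}  coeff A w (p , q) fA≡1+w n =
  sym (trans (ℚₚ.+-identityʳ _)
    (trans (cong₂ ℚ._+_ (ℚₚ.*-zeroˡ (toℚ p)) (ℚₚ.*-zeroˡ (toℚ q))) refl))
∑-dot {suc k} coeff A w f@(p , q) fA≡1+w n = begin
  c₀ ℚ.* toℚ (+ w zero) ℚ.+ seq (∑ (λ i → coeff (suc i) · toℚ (+ w (suc i)))) n
    ≡⟨ cong₂ (λ u v → c₀ ℚ.* u ℚ.+ v) head (∑-dot (coeff ∘ suc) (A ∘ suc) (w ∘ suc) f (fA≡1+w ∘ suc) n) ⟩
  c₀ ℚ.* (toℚ p ℚ.* x ℚ.+ toℚ q ℚ.* y ℚ.- 1ℚ) ℚ.+ (X ℚ.* toℚ p ℚ.+ Y ℚ.* toℚ q ℚ.- C)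
    ≡⟨ regroup c₀ x y X Y C (toℚ p) (toℚ q) ⟩
  (c₀ ℚ.* x ℚ.+ X) ℚ.* toℚ p ℚ.+ (c₀ ℚ.* y ℚ.+ Y) ℚ.* toℚ q ℚ.- (c₀ ℚ.+ C) ∎
  where
  open ≡-Reasoning
  c₀ = seq (coeff zero) n
  x = toℚ (proj₁ (A zero))
  y = toℚ (proj₂ (A zero))
  X = seq (∑ (λ i → coeff (suc i) · (proj₁ (A (suc i)) ℚ./ 1))) n
  Y = seq (∑ (λ i → coeff (suc i) · (proj₂ (A (suc i)) ℚ./ 1))) n
  C = seq (∑ (coeff ∘ suc)) n

  head : toℚ (+ w zero) ≡ toℚ p ℚ.* x ℚ.+ toℚ q ℚ.* y ℚ.- 1ℚ
  head = begin
    -- `+[1+ m ] ℤ.+ ℤ.-1ℤ` computes to `+ m`, which brings in the positive value of `f`.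
    toℚ (+ w zero)                                   ≡⟨⟩
    toℚ (+[1+ w zero ] ℤ.+ ℤ.-1ℤ)                    ≡⟨ toℚ-+ +[1+ w zero ] ℤ.-1ℤ ⟩
    toℚ +[1+ w zero ] ℚ.- 1ℚ                         ≡⟨ cong (λ z → toℚ z ℚ.- 1ℚ) (fA≡1+w zero) ⟨
    toℚ (dot f (A zero)) ℚ.- 1ℚ                      ≡⟨ cong (ℚ._- 1ℚ) (toℚ-+ (p ℤ.* proj₁ (A zero)) (q ℤ.* proj₂ (A zero))) ⟩
    toℚ (p ℤ.* proj₁ (A zero)) ℚ.+ toℚ (q ℤ.* proj₂ (A zero)) ℚ.- 1ℚ
      ≡⟨ cong₂ (λ u v → u ℚ.+ v ℚ.- 1ℚ) (toℚ-* p (proj₁ (A zero))) (toℚ-* q (proj₂ (A zero))) ⟩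
    toℚ p ℚ.* x ℚ.+ toℚ q ℚ.* y ℚ.- 1ℚ               ∎

  regroup : ∀ c x y X Y C p q →
    c ℚ.* (p ℚ.* x ℚ.+ q ℚ.* y ℚ.- 1ℚ) ℚ.+ (X ℚ.* p ℚ.+ Y ℚ.* q ℚ.- C) ≡
    (c ℚ.* x ℚ.+ X) ℚ.* p ℚ.+ (c ℚ.* y ℚ.+ Y) ℚ.* q ℚ.- (c ℚ.+ C)
  regroup = solve 8 (λ c x y X Y C p q →
    c :* (p :* x :+ q :* y :- con 1ℚ) :+ (X :* p :+ Y :* q :- C) :=
    (c :* x :+ X) :* p :+ (c :* y :+ Y) :* q :- (c :+ C)) refl
    where open +-*-Solver

positive⇒suc : ∀ {i} → 0ℤ ℤ.< i → ∃[ w ] (i ≡ +[1+ w ])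
positive⇒suc {+[1+ w ]} _ = w , refl
positive⇒suc {+ 0} (ℤ.+<+ ())

-- Four asymptotically nonnegative sequences, namely ∑ cᵢ (f(Aᵢ) - 1), the negated coordinate sums
-- times `p` and `q`, and ∑ cᵢ - 1, add up to the constant -1 at every index.
positive⇒O∉Conv : ∀ {k} (A : Fin k → ℤ²) (coeff : Fin k → ℝ) (f : ℤ²) →
                  (∀ i → 0ℤ ℤ.< dot f (A i)) → (∀ i → 0ᴿ ≤ᴿ coeff i) → ∑ coeff ≃ 1ᴿ →
                  ∑ (λ i → coeff i · (proj₁ (A i) ℚ./ 1)) ≃ fromℤ 0ℤ →
                  ∑ (λ i → coeff i · (proj₂ (A i) ℚ./ 1)) ≃ fromℤ 0ℤ → ⊥
-- With ε = 1 the bound for the constant -1 reads 0 < -1 + 1, which computes to 0 < 0.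
positive⇒O∉Conv A coeff f@(p , q) 0<fA 0≤coeff ∑≃1 ∑₁≃0 ∑₂≃0 = 0≮0 (proj₂ (bound -1≥0 1ℚ (ℚₚ.positive⁻¹ 1ℚ)))
  where
  w = λ i → proj₁ (positive⇒suc (0<fA i))
  x = ∑ (λ i → coeff i · (proj₁ (A i) ℚ./ 1))
  y = ∑ (λ i → coeff i · (proj₂ (A i) ℚ./ 1))

  total : ∀ n → seq (∑ (λ i → coeff i · toℚ (+ w i))) n ℚ.+
    ((ℚ.- (seq x n ℚ.- 0ℚ)) ℚ.* toℚ p ℚ.+ (ℚ.- (seq y n ℚ.- 0ℚ)) ℚ.* toℚ q) ℚ.+
    (seq (∑ coeff) n ℚ.- 1ℚ) ≡ ℚ.- 1ℚ
  total n = trans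
    (cong (λ z → z ℚ.+ ((ℚ.- (seq x n ℚ.- 0ℚ)) ℚ.* toℚ p ℚ.+ (ℚ.- (seq y n ℚ.- 0ℚ)) ℚ.* toℚ q) ℚ.+
                 (seq (∑ coeff) n ℚ.- 1ℚ))
      (∑-dot coeff A w f (λ i → proj₂ (positive⇒suc (0<fA i))) n))
    (solve 5 (λ x y s p q →
      (x :* p :+ y :* q :- s) :+ ((:- (x :- con 0ℚ)) :* p :+ (:- (y :- con 0ℚ)) :* q) :+ (s :- con 1ℚ)
      := con (ℚ.- 1ℚ)) refl (seq x n) (seq y n) (seq (∑ coeff) n) (toℚ p) (toℚ q))
    where open +-*-Solver

  -1≥0 : AsymptoticallyNonneg (λ _ → ℚ.- 1ℚ)
  -1≥0 = nonneg-resp total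
    (nonneg-+ (nonneg-+ (∑-nonneg coeff w 0≤coeff)
                        (nonneg-+ (≃⇒negated-*ℤ x (fromℤ 0ℤ) p ∑₁≃0)
                                  (≃⇒negated-*ℤ y (fromℤ 0ℤ) q ∑₂≃0)))
              (≃⇒nonneg (∑ coeff) 1ᴿ ∑≃1))

  0≮0 : ∀ {N} → (∀ n → N ℕ.≤ n → 0ℚ ℚ.< 0ℚ) → ⊥
  0≮0 0<0 = ℚₚ.<-irrefl refl (0<0 _ ℕₚ.≤-refl)

conv⇒units : (S : Submonoid ℓ) → ι O ∈ Conv (Mem S ∖O) → HasNontrivialUnits (Mem S)
conv⇒units S (k , A , coeff , A∈S , 0≤coeff , ∑≃1 , ∑₁≃0 , ∑₂≃0) =
  [ id , (λ (f , 0<fA) → ⊥-elim (positive⇒O∉Conv A coeff f 0<fA 0≤coeff ∑≃1 ∑₁≃0 ∑₂≃0)) ]′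
    (gordan S A A∈S)

-- Convex combinations with equal weights

pointwise-≃ : ∀ x y → (∀ n → seq x n ≡ seq y n) → x ≃ y
pointwise-≃ x y x≡y ε 0<ε = 0 , λ n _ →
  subst (λ z → ∣ z ℚ.- seq y n ∣ ℚ.< ε) (sym (x≡y n))
    (subst (ℚ._< ε) (sym (cong ∣_∣ (ℚₚ.+-inverseʳ (seq y n)))) 0<ε)

∑-const : ∀ r k n → seq (∑ {k} (λ _ → fromℚ r)) n ≡ r ℚ.* toℚ (+ k)
∑-const r zero    n = sym (ℚₚ.*-zeroʳ r)
∑-const r (suc k) n = begin
  r ℚ.+ seq (∑ {k} (λ _ → fromℚ r)) n   ≡⟨ cong₂ ℚ._+_ (sym (ℚₚ.*-identityʳ r)) (∑-const r k n) ⟩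
  r ℚ.* 1ℚ ℚ.+ r ℚ.* toℚ (+ k)          ≡⟨ ℚₚ.*-distribˡ-+ r 1ℚ (toℚ (+ k)) ⟨
  r ℚ.* (1ℚ ℚ.+ toℚ (+ k))              ≡⟨ cong (r ℚ.*_) (toℚ-+ 1ℤ (+ k)) ⟨
  r ℚ.* toℚ (+ suc k)                   ∎
  where open ≡-Reasoning

∑-scaled : ∀ {k} r (i : Fin k → ℤ) n →
           seq (∑ (λ j → fromℚ r · (i j ℚ./ 1))) n ≡ r ℚ.* toℚ (∑ℤ i)
∑-scaled {zero}  r i n = sym (ℚₚ.*-zeroʳ r)
∑-scaled {suc k} r i n = begin
  r ℚ.* toℚ (i zero) ℚ.+ seq (∑ (λ j → fromℚ r · (i (suc j) ℚ./ 1))) n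
    ≡⟨ cong (r ℚ.* toℚ (i zero) ℚ.+_) (∑-scaled r (i ∘ suc) n) ⟩
  r ℚ.* toℚ (i zero) ℚ.+ r ℚ.* toℚ (∑ℤ (i ∘ suc))
    ≡⟨ ℚₚ.*-distribˡ-+ r (toℚ (i zero)) (toℚ (∑ℤ (i ∘ suc))) ⟨
  r ℚ.* (toℚ (i zero) ℚ.+ toℚ (∑ℤ (i ∘ suc)))
    ≡⟨ cong (r ℚ.*_) (toℚ-+ (i zero) (∑ℤ (i ∘ suc))) ⟨
  r ℚ.* toℚ (∑ℤ i) ∎
  where open ≡-Reasoning

∑ℤ-proj₁ : ∀ w → ∑ℤ (λ j → proj₁ (lookup w j)) ≡ proj₁ (α w)
∑ℤ-proj₁ []            = refl
∑ℤ-proj₁ ((i , _) ∷ w) = cong (λ k → i ℤ.+ k) (∑ℤ-proj₁ w)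

∑ℤ-proj₂ : ∀ w → ∑ℤ (λ j → proj₂ (lookup w j)) ≡ proj₂ (α w)
∑ℤ-proj₂ []            = refl
∑ℤ-proj₂ ((_ , i) ∷ w) = cong (λ k → i ℤ.+ k) (∑ℤ-proj₂ w)

∑-scaled-zero : ∀ {k} r (i : Fin k → ℤ) → ∑ℤ i ≡ 0ℤ → ∑ (λ j → fromℚ r · (i j ℚ./ 1)) ≃ fromℤ 0ℤ
∑-scaled-zero r i ∑i≡0 = pointwise-≃ (∑ (λ j → fromℚ r · (i j ℚ./ 1))) (fromℤ 0ℤ) λ n →
  trans (∑-scaled r i n) (trans (cong (λ j → r ℚ.* toℚ j) ∑i≡0) (ℚₚ.*-zeroʳ r))

length-nonZero : ∀ (w : Word) → w ≢ [] → ℕ.NonZero (length w)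
length-nonZero []      w≢[] = ⊥-elim (w≢[] refl)
length-nonZero (_ ∷ _) _    = _

-- Nonemptiness lets every position carry the weight 1 / length. Repeated letters are harmless,
-- because `Conv` takes an indexed family of points rather than distinct ones.
closedWord⇒conv : ∀ {P : Pred ℤ² ℓ} w → w ≢ [] → All P w → α w ≡ O → ι O ∈ Conv P
closedWord⇒conv w w≢[] w∈P αw≡O =
  length w , lookup w , (λ _ → fromℚ r) ,
  (λ i → All.lookup w∈P (∈-lookup i)) ,
  (λ _ ε 0<ε → 0 , λ _ _ → ℚₚ.+-mono-≤-< 0≤r 0<ε) ,
  pointwise-≃ (∑ {length w} (λ _ → fromℚ r)) 1ᴿ (λ n → trans (∑-const r (length w) n) (ℚₚ.*-inverseˡ l)) ,
  ∑-scaled-zero r (λ i → proj₁ (lookup w i)) (trans (∑ℤ-proj₁ w) (cong proj₁ αw≡O)) ,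
  ∑-scaled-zero r (λ i → proj₂ (lookup w i)) (trans (∑ℤ-proj₂ w) (cong proj₂ αw≡O))
  where
  l : ℚ
  l = toℚ (+ length w)

  instance
    l-pos : ℚ.Positive l
    -- `l` unfolds to the normalised fraction `length w` over 1, positive because the word is
    -- nonempty.
    l-pos = ℚₚ.normalize-pos (length w) 1 {{_}} {{length-nonZero w w≢[]}}

    l-nonZero : ℚ.NonZero l
    l-nonZero = ℚₚ.pos⇒nonZero l

  r : ℚ
  r = ℚ.1/ l

  0≤r : 0ℚ ℚ.≤ r
  0≤r = ℚₚ.<⇒≤ (ℚₚ.positive⁻¹ r {{ℚₚ.1/pos⇒pos l}})

-- A unit and its inverse form a two-letter word with sum `O`, where the letters are elements of `M`
-- instead of steps.
units⇒conv : {M : Pred ℤ² ℓ} → HasNontrivialUnits M → ι O ∈ Conv (M ∖O)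
units⇒conv (U , U∈M , U≢O , V , V∈M , U⊕V≡O) =
  closedWord⇒conv (U ∷ V ∷ []) (λ ()) ((U∈M , U≢O) ∷ (V∈M , V≢O) ∷ [])
    (trans (cong (U ⊕_) (⊕-identityʳ V)) U⊕V≡O)
  where
  V≢O : V ≢ O
  V≢O V≡O = U≢O (trans (sym (⊕-identityʳ U)) (trans (cong (U ⊕_) (sym V≡O)) U⊕V≡O))

-- Paths with prefix sums in a submonoid

α-++ : ∀ v w → α (v ++ w) ≡ α v ⊕ α w
α-++ []      w = sym (⊕-identityˡ (α w))
α-++ (A ∷ v) w = trans (cong (A ⊕_) (α-++ v w)) (sym (⊕-assoc A (α v) (α w)))

take-++ : ∀ m (v w : Word) → take m (v ++ w) ≡ take m v ++ take (m ℕ.∸ length v) w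
take-++ zero    []      w = refl
take-++ zero    (A ∷ v) w = refl
take-++ (suc m) []      w = refl
take-++ (suc m) (A ∷ v) w = cong (A ∷_) (take-++ m v w)

module _ (X : StepSet a) (C : Submonoid c) where

  prefix∈C : ∀ {w} → w ∈ ℱ[ X , C ] → ∀ m → α (σ m w) ∈ Mem C
  prefix∈C {w} (_ , prefixes) m with ℕₚ.≤-total m (length w)
  ... | inj₁ m≤l = prefixes m m≤l
  ... | inj₂ l≤m = subst (λ v → α v ∈ Mem C)
    (trans (take-all (length w) w ℕₚ.≤-refl) (sym (take-all m w l≤m)))
    (prefixes (length w) ℕₚ.≤-refl)

  α∈C : ∀ {w} → w ∈ ℱ[ X , C ] → α w ∈ Mem C
  α∈C {w} w∈ℱ = subst (λ v → α v ∈ Mem C) (take-all (length w) w ℕₚ.≤-refl) (prefix∈C w∈ℱ (length w))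

  -- A prefix of `v ++ w` is a prefix of `v` followed by a prefix of `w`; truncated subtraction
  -- makes the latter empty until `v` is used up. Both sums lie in `C`, hence so does their total.
  ++-closed : ∀ {v w} → v ∈ ℱ[ X , C ] → w ∈ ℱ[ X , C ] → v ++ w ∈ ℱ[ X , C ]
  ++-closed {v} {w} v∈ℱ w∈ℱ = ++⁺ (proj₁ v∈ℱ) (proj₁ w∈ℱ) , λ m _ →
    subst (_∈ Mem C) (sym (trans (cong α (take-++ m v w)) (α-++ (take m v) _)))
      (⊕-closed C (prefix∈C v∈ℱ m) (prefix∈C w∈ℱ (m ℕ.∸ length v)))

  []∈paths : [] ∈ paths X C O
  []∈paths = ([] , λ { zero _ → O∈Mem C }) , refl

  paths-++ : ∀ {v w A B} → v ∈ paths X C A → w ∈ paths X C B → v ++ w ∈ paths X C (A ⊕ B)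
  paths-++ {v} {w} (v∈ℱ , αv≡A) (w∈ℱ , αw≡B) =
    ++-closed v∈ℱ w∈ℱ , trans (α-++ v w) (cong₂ _⊕_ αv≡A αw≡B)

  𝒜-submonoid : Submonoid (a ⊔ˡ c)
  𝒜-submonoid = record
    { Mem      = 𝒜[ X , C ]
    ; O∈Mem    = [] , []∈paths
    ; ⊕-closed = λ (v , v∈paths) (w , w∈paths) → v ++ w , paths-++ v∈paths w∈paths
    }

  loop⇒IPP : ∀ {v} → v ≢ [] → v ∈ paths X C O → IPP X C
  loop⇒IPP {v} v≢[] v∈paths A (w , w∈paths) = mk↣ loops-injective , loops∈paths
    where
    loops : ℕ → Word
    loops zero    = w
    loops (suc n) = v ++ loops n

    loops∈paths : ∀ n → loops n ∈ paths X C A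
    loops∈paths zero    = w∈paths
    loops∈paths (suc n) = subst (λ B → loops (suc n) ∈ paths X C B) (⊕-identityˡ A)
      (paths-++ v∈paths (loops∈paths n))

    length-loops : ∀ n → length (loops n) ≡ n ℕ.* length v ℕ.+ length w
    length-loops zero    = refl
    length-loops (suc n) = trans (length-++ v) (trans (cong (length v ℕ.+_) (length-loops n))
      (sym (ℕₚ.+-assoc (length v) (n ℕ.* length v) (length w))))

    -- Lengths tell the words apart: each copy of `v` adds the nonzero amount `length v`.
    loops-injective : ∀ {m n} → loops m ≡ loops n → m ≡ n
    loops-injective {m} {n} eq = ℕₚ.*-cancelʳ-≡ m n (length v) {{length-nonZero v v≢[]}}
      (ℕₚ.+-cancelʳ-≡ (length w) _ _
        (trans (sym (length-loops m)) (trans (cong length eq) (length-loops n))))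

  -- The empty word is a path to `O`, so infinitely many such paths exist. By injectivity the first
  -- two of the sequence cannot both be empty.
  IPP⇒loop : IPP X C → ∃[ v ] (v ≢ [] × v ∈ paths X C O)
  IPP⇒loop ipp with ipp O ([] , []∈paths)
  ... | f , f∈paths with Injection.to f 0 in f0≡
  ...   | A ∷ v = A ∷ v , (λ ()) , subst (_∈ paths X C O) f0≡ (f∈paths 0)
  ...   | []    = Injection.to f 1 , f1≢[] , f∈paths 1
    where
    f1≢[] : Injection.to f 1 ≢ []
    f1≢[] f1≡[] with Injection.injective f (trans f0≡ (sym f1≡[]))
    ... | ()

  -- Concatenating paths to a unit and to its inverse gives a loop, nonempty because the first path
  -- ends away from `O`.
  units⇒IPP : HasNontrivialUnits 𝒜[ X , C ] → IPP X C
  units⇒IPP (U , (u , u∈paths) , U≢O , V , (v , v∈paths) , U⊕V≡O) =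
    loop⇒IPP uv≢[] (subst (λ A → u ++ v ∈ paths X C A) U⊕V≡O (paths-++ u∈paths v∈paths))
    where
    uv≢[] : u ++ v ≢ []
    uv≢[] uv≡[] = U≢O (trans (sym (proj₂ u∈paths)) (cong α (++-conicalˡ u v uv≡[])))

  IPP⇒conv : IPP X C → ι O ∈ Conv (Step X)
  IPP⇒conv ipp with IPP⇒loop ipp
  ... | v , v≢[] , (v∈ℱ , _) , αv≡O = closedWord⇒conv v v≢[] v∈ℱ αv≡O

  conv⇔units : (ι O ∈ Conv (𝒜[ X , C ] ∖O)) ⇔ HasNontrivialUnits 𝒜[ X , C ]
  conv⇔units = mk⇔ (conv⇒units 𝒜-submonoid) units⇒conv

  -- A word is a prefix of itself, so its sum lies in `C`. The counterexamples thus only require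
  -- that `C` has no units.
  units-C : HasNontrivialUnits 𝒜[ X , C ] → HasNontrivialUnits (Mem C)
  units-C (U , U∈𝒜 , U≢O , V , V∈𝒜 , U⊕V≡O) = U , 𝒜⊆C U∈𝒜 , U≢O , V , 𝒜⊆C V∈𝒜 , U⊕V≡O
    where
    𝒜⊆C : ∀ {A} → A ∈ 𝒜[ X , C ] → A ∈ Mem C
    𝒜⊆C (w , w∈ℱ , αw≡A) = subst (_∈ Mem C) αw≡A (α∈C w∈ℱ)

-- Counterexamples

east west : ℤ²
east = 1ℤ , 0ℤ
west = ℤ.-1ℤ , 0ℤ

-- `Lift` places the example at an arbitrary universe level, so that the implications are refuted at
-- every level.
horizontal : StepSet a
horizontal = record
  { Step   = λ A → Lift _ (A ≡ east ⊎ A ≡ west)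
  ; O∉Step = λ { (lift (inj₁ ())) ; (lift (inj₂ ())) }
  }

halfLine : Submonoid c
halfLine = record
  { Mem      = λ (i , j) → Lift _ (0ℤ ℤ.≤ i × j ≡ 0ℤ)
  ; O∈Mem    = lift (ℤₚ.≤-refl , refl)
  ; ⊕-closed = λ { (lift (0≤i , refl)) (lift (0≤k , refl)) → lift (ℤₚ.+-mono-≤ 0≤i 0≤k , refl) }
  }

trivial : Submonoid c
trivial = record
  { Mem      = λ A → Lift _ (A ≡ O)
  ; O∈Mem    = lift refl
  ; ⊕-closed = λ { (lift refl) (lift refl) → lift refl }
  }

east∈ : east ∈ Step (horizontal {a})
east∈ = lift (inj₁ refl)

west∈ : west ∈ Step (horizontal {a})
west∈ = lift (inj₂ refl)

-- The inverse of a point with positive first coordinate would have a negative one.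
halfLine-noUnits : ¬ HasNontrivialUnits (Mem (halfLine {c}))
halfLine-noUnits ((+ zero , _)  , lift (_ , refl) , U≢O , _) = U≢O refl
halfLine-noUnits ((+[1+ _ ] , _) , _ , _ , (+ _ , _) , _ , ())
halfLine-noUnits ((+[1+ _ ] , _) , _ , _ , (-[1+ _ ] , _) , lift (() , _) , _)
halfLine-noUnits ((-[1+ _ ] , _) , lift (() , _) , _)

trivial-noUnits : ¬ HasNontrivialUnits (Mem (trivial {c}))
trivial-noUnits (_ , lift U≡O , U≢O , _) = U≢O U≡O

-- The order of the steps matters: going east first keeps the loop in the half-line, while going
-- west first would leave it.
halfLine-IPP : IPP (horizontal {a}) (halfLine {c})
halfLine-IPP = loop⇒IPP horizontal halfLine {east ∷ west ∷ []} (λ ())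
  ((east∈ ∷ west∈ ∷ [] , prefixes) , refl)
  where
  prefixes : ∀ m → m ℕ.≤ 2 → α (σ m (east ∷ west ∷ [])) ∈ Mem halfLine
  prefixes 0 _ = lift (ℤ.+≤+ ℕ.z≤n , refl)
  prefixes 1 _ = lift (ℤ.+≤+ ℕ.z≤n , refl)
  prefixes 2 _ = lift (ℤ.+≤+ ℕ.z≤n , refl)
  prefixes (suc (suc (suc _))) (ℕ.s≤s (ℕ.s≤s ()))

-- The first letter of a nonempty loop is itself a prefix sum, so it would have to be `O`, which is
-- not a step.
trivial-noIPP : (X : StepSet a) → ¬ IPP X (trivial {c})
trivial-noIPP X ipp with IPP⇒loop X trivial ipp
... | []    , v≢[] , _ = v≢[] refl
... | A ∷ v , _ , (A∈X ∷ _ , prefixes) , _ =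
  O∉Step X (subst (_∈ Step X) (trans (sym (⊕-identityʳ A)) (lower (prefixes 1 (ℕ.s≤s ℕ.z≤n)))) A∈X)

horizontal-conv : ι O ∈ Conv (Step (horizontal {a}))
horizontal-conv = closedWord⇒conv {P = Step horizontal} (east ∷ west ∷ []) (λ ()) (east∈ ∷ west∈ ∷ []) refl

proposition3p10 : ∀ {a c} →
    ((X : StepSet a) (C : Submonoid c) → (ι O ∈ Conv (𝒜[ X , C ] ∖O)) ⇔ HasNontrivialUnits 𝒜[ X , C ]) ×
    ((X : StepSet a) (C : Submonoid c) → HasNontrivialUnits 𝒜[ X , C ] → IPP X C) ×
    ((X : StepSet a) (C : Submonoid c) → IPP X C → ι O ∈ Conv (Step X)) ×
    (¬ ((X : StepSet a) (C : Submonoid c) → IPP X C → ι O ∈ Conv (𝒜[ X , C ] ∖O))) ×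
    (¬ ((X : StepSet a) (C : Submonoid c) → IPP X C → HasNontrivialUnits 𝒜[ X , C ])) ×
    (¬ ((X : StepSet a) (C : Submonoid c) → ι O ∈ Conv (Step X) → IPP X C)) ×
    (¬ ((X : StepSet a) (C : Submonoid c) → ι O ∈ Conv (Step X) → ι O ∈ Conv (𝒜[ X , C ] ∖O))) ×
    (¬ ((X : StepSet a) (C : Submonoid c) → ι O ∈ Conv (Step X) → HasNontrivialUnits 𝒜[ X , C ]))
proposition3p10 =
  conv⇔units ,
  units⇒IPP ,
  IPP⇒conv ,
  -- Convex combinations are never examined directly: (iii) is first turned into (iv), which fails
  -- because `halfLine` has no units.
  (λ i⇒iii  → noUnits-halfLine (conv⇒units (𝒜-submonoid horizontal halfLine) (i⇒iii horizontal halfLine halfLine-IPP))) ,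
  (λ i⇒iv   → noUnits-halfLine (i⇒iv horizontal halfLine halfLine-IPP)) ,
  (λ ii⇒i   → trivial-noIPP horizontal (ii⇒i horizontal trivial horizontal-conv)) ,
  (λ ii⇒iii → noUnits-trivial (conv⇒units (𝒜-submonoid horizontal trivial) (ii⇒iii horizontal trivial horizontal-conv))) ,
  (λ ii⇒iv  → noUnits-trivial (ii⇒iv horizontal trivial horizontal-conv))
  where
  noUnits-halfLine : ¬ HasNontrivialUnits 𝒜[ horizontal , halfLine ]
  noUnits-halfLine = halfLine-noUnits ∘ units-C horizontal halfLine

  noUnits-trivial : ¬ HasNontrivialUnits 𝒜[ horizontal , trivial ]
  noUnits-trivial = trivial-noUnits ∘ units-C horizontal trivial
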